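{- There exists an infinite class of minimal temporal graphs on $n$ vertices with $\Theta(n\cdot\log n)$ edges and $\Theta(n\cdot\log n)$ labels, such that different edges have different labels.
   Context: A temporal graph is a triple $G(L)=(V,E,L)$ where $(V,E)$ is a graph and $L=\{L_e\subseteq\mathbb{N}^*:e\in E\}$ assigns to each edge a set of positive integer labels; the number of labels is $\sum_{e\in E}|L_e|$. A $(u,v)$-journey is a sequence $(u,u_1,l_1),(u_1,u_2,l_2),\ldots,(u_{k-1},v,l_k)$ in which each consecutive pair of vertices forms an edge $e$ with the corresponding label in $L_e$, and $l_1<l_2<\cdots<l_k$. $G(L)$ satisfies TC (is temporally connected) if for every ordered pair of distinct vertices $u,v$ there is a $(u,v)$-journey. A temporal graph $G(L)$ over a connected graph is minimal if it satisfies TC and the removal of any single label from any $L_e$, $e\in E$, results in a temporal graph that does not satisfy TC. "Different edges have different labels" means that no label is assigned to two different edges. -}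

module Defs where

open import Data.Fin.Base using (Fin; _<_)
open import Data.List.Base using (List; length; filter)
open import Data.List.Membership.Propositional using () renaming (_∈_ to _∈ˡ_)
open import Data.List.Relation.Unary.All using (All)
import Data.List.Relation.Unary.All.Properties as All
open import Data.List.Relation.Unary.Unique.Propositional using (Unique)
import Data.List.Relation.Unary.Unique.Propositional.Properties as Unique
open import Data.Nat.Base as ℕ using (ℕ; NonZero; _+_; _*_; _≤_; _≥_)
open import Data.Nat.Logarithm using (⌊log₂_⌋)
open import Data.Nat.Properties using (_≟_)
open import Data.Product.Base using (_×_; _,_; proj₁; proj₂; ∃-syntax)
open import Data.Sum.Base using (_⊎_)
open import Data.Vec.Functional using (Vector; foldr; map; updateAt)
open import Function.Definitions using (Injective)
open import Level using (0ℓ)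
open import Relation.Binary.Construct.Closure.ReflexiveTransitive using (Star)
open import Relation.Binary.PropositionalEquality using (_≡_; _≢_)
open import Relation.Nullary using (¬_; ¬?)
open import Relation.Unary using (Pred)

-- Finite simple undirected graphs on the vertex set Fin n.  The edge set is
-- Fin #edges; the unordered pair {u , v} is stored as (u , v) with u < v, so
-- there are no loops, and injectivity excludes parallel edges.
record Graph (n : ℕ) : Set where
  field
    #edges         : ℕ
    ends           : Fin #edges → Fin n × Fin n
    ends-ordered   : ∀ e → proj₁ (ends e) < proj₂ (ends e)
    ends-injective : Injective _≡_ _≡_ ends

  Edge : Set
  Edge = Fin #edges

  Joins : Edge → Fin n → Fin n → Set
  Joins e u v = ends e ≡ (u , v) ⊎ ends e ≡ (v , u)

  Adjacent : Fin n → Fin n → Set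
  Adjacent u v = ∃[ e ] Joins e u v

  Connected : Set
  Connected = ∀ u v → Star Adjacent u v

-- Finite sets of positive integers, as duplicate-free lists (so that length is
-- cardinality).
record LabelSet : Set where
  field
    elements : List ℕ
    unique   : Unique elements
    positive : All NonZero elements

open LabelSet

infix 4 _∈_

_∈_ : ℕ → LabelSet → Set
l ∈ S = l ∈ˡ elements S

∣_∣ : LabelSet → ℕ
∣ S ∣ = length (elements S)

delete : ℕ → LabelSet → LabelSet
delete l S = record
  { elements = filter l≢? (elements S)
  ; unique   = Unique.filter⁺ l≢? (unique S)
  ; positive = All.filter⁺ l≢? (positive S)
  }
  where l≢? = λ k → ¬? (l ≟ k)

record TemporalGraph (n : ℕ) : Set where
  field
    graph : Graph n

  open Graph graph public

  field
    L : Vector LabelSet #edges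

  #labels : ℕ
  #labels = foldr _+_ 0 (map ∣_∣ L)

  TimeEdge : Fin n → Fin n → ℕ → Set
  TimeEdge u v l = ∃[ e ] Joins e u v × l ∈ L e

  -- JourneyFrom l u v: nonempty journeys from u to v whose first label is l.
  data JourneyFrom (l : ℕ) (u v : Fin n) : Set where
    last : TimeEdge u v l → JourneyFrom l u v
    step : ∀ {w l′} → TimeEdge u w l → l ℕ.< l′ →
           JourneyFrom l′ w v → JourneyFrom l u v

  Journey : Fin n → Fin n → Set
  Journey u v = ∃[ l ] JourneyFrom l u v

  TC : Set
  TC = ∀ u v → u ≢ v → Journey u v

  DifferentEdgesDifferentLabels : Set
  DifferentEdgesDifferentLabels = ∀ e e′ → e ≢ e′ → ∀ l → ¬ (l ∈ L e × l ∈ L e′)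

open TemporalGraph

removeLabel : ∀ {n} (G : TemporalGraph n) → Edge G → ℕ → TemporalGraph n
removeLabel G e l = record { graph = graph G ; L = updateAt (L G) e (delete l) }

record Minimal {n : ℕ} (G : TemporalGraph n) : Set where
  field
    connected : Connected G
    tc        : TC G
    removal   : ∀ e l → l ∈ L G e → ¬ TC (removeLabel G e l)

Class : Set₁
Class = ∀ n → Pred (TemporalGraph n) 0ℓ

-- Asymptotics in n are only meaningful if n is unbounded over the class, so
-- infinite means that the class has members of arbitrarily large order.
Infinite : Class → Set
Infinite 𝒞 = ∀ N → ∃[ n ] n ≥ N × ∃[ G ] 𝒞 n G

-- f G = Θ(g n) as n → ∞, for G on n vertices ranging over 𝒞.  Positive real
-- constants c₁ and c₂ with c₁ g ≤ f ≤ c₂ g may be taken of the form c₁ = 1/a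
-- and c₂ = b with a and b positive integers.
Θ[_] : Class → (∀ {n} → TemporalGraph n → ℕ) → (ℕ → ℕ) → Set
Θ[ 𝒞 ] f g = ∃[ a ] ∃[ b ] ∃[ n₀ ] NonZero a × NonZero b ×
  (∀ n → n ≥ n₀ → ∀ G → 𝒞 n G → g n ≤ a * f G × f G ≤ b * g n)

-- Rounding the logarithm down, and the choice of base, change it only by a
-- bounded factor for n ≥ 2.
n·log : ℕ → ℕ
n·log n = n * ⌊log₂ n ⌋

{-# OPTIONS --safe #-}
module Submission where

open import Data.Bool.Base using (Bool; true; false; not)
open import Data.Bool.Properties using (not-¬)
open import Data.Empty using (⊥-elim)
open import Data.Fin.Base as Fin using (Fin; toℕ; splitAt; _↑ˡ_; _↑ʳ_)
open import Data.Fin.Properties as Fin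
  using (toℕ<n; toℕ-↑ˡ; toℕ-↑ʳ; splitAt-↑ˡ; splitAt-↑ʳ; splitAt⁻¹-↑ˡ; splitAt⁻¹-↑ʳ)
open import Data.List.Base using ([]; _∷_)
open import Data.List.Membership.Propositional.Properties using (∈-filter⁻)
open import Data.List.Relation.Unary.All using ([]; _∷_)
open import Data.List.Relation.Unary.AllPairs using ([]; _∷_)
open import Data.List.Relation.Unary.Any using (here)
open import Data.Nat.Base as ℕ using (ℕ; zero; suc; _+_; _*_; _^_; s<s; z<s)
open import Data.Nat.Logarithm using (⌊log₂_⌋; ⌊log₂[2^n]⌋≡n)
open import Data.Nat.Properties as ℕ using ()
open import Data.Nat.Tactic.RingSolver using (solve-∀)
open import Data.Product.Base using (_×_; _,_; proj₁; proj₂; ∃-syntax; map)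
open import Data.Product.Properties using (,-injectiveˡ; ,-injectiveʳ)
open import Data.Sum.Base using (inj₁; inj₂; [_,_]′)
open import Data.Vec.Functional using (foldr)
open import Data.Vec.Functional.Properties using (updateAt-updates; updateAt-minimal)
open import Function.Base using (_∘_)
open import Level using (0ℓ)
open import Relation.Binary.Construct.Closure.ReflexiveTransitive using (Star; ε; _◅_)
open import Relation.Binary.PropositionalEquality
  using (_≡_; _≢_; refl; sym; trans; cong; cong₂; subst; subst₂; module ≡-Reasoning)
open import Relation.Nullary using (¬_; ¬?; yes; no; contradiction)
open import Relation.Unary using (Pred; U)
open import Defs
open TemporalGraph using (#edges; #labels; DifferentEdgesDifferentLabels)
open Graph using (Edge; Joins; ends; ends-ordered; ends-injective)

-- The graphs are hypercubes.  The cube of dimension d + 1 consists of two copies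
-- of the cube of dimension d and a perfect matching of rungs between them; its
-- edges are numbered with the first copy first, then the second copy, then the
-- rungs, and edge number i has the single label i + 1.  A journey cannot continue
-- after a rung: the later edges are rungs, and the only one at hand has just been
-- used.  So a journey ending in the copy where it starts is a journey of that
-- copy, and a journey ending at the other copy ends with the rung of its
-- endpoint.  By induction, the endpoints of an edge are joined by no journey
-- avoiding that edge, so every label is needed.

-- Journeys of the temporal graph in which edge number i has the single label
-- i + 1, restricted to edges satisfying P and indexed by the first edge.
data Trail {n} (g : Graph n) (P : Pred (Edge g) 0ℓ) : Edge g → Fin n → Fin n → Set where
  last : ∀ {e u v} → P e → Joins g e u v → Trail g P e u v
  step : ∀ {e e′ u w v} → P e → Joins g e u w → e Fin.< e′ →
         Trail g P e′ w v → Trail g P e u v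

module _ {n} {g : Graph n} where

  mapTrail : ∀ {P Q : Pred (Edge g) 0ℓ} → (∀ {e} → P e → Q e) →
             ∀ {e u v} → Trail g P e u v → Trail g Q e u v
  mapTrail f (last p j)       = last (f p) j
  mapTrail f (step p j e<f t) = step (f p) j e<f (mapTrail f t)

  first-satisfies : ∀ {P : Pred (Edge g) 0ℓ} {e u v} → Trail g P e u v → P e
  first-satisfies (last p _)     = p
  first-satisfies (step p _ _ _) = p

  first-incident : ∀ {P : Pred (Edge g) 0ℓ} {e u v} → Trail g P e u v → ∃[ w ] Joins g e u w
  first-incident (last _ j)     = _ , j
  first-incident (step _ j _ _) = _ , j

-- The invariant carried through the doubling. `unavoidable` takes the ends of an edge in their
-- stored order only, since one missing journey already refutes temporal connectivity.
record Sharp {n} (g : Graph n) : Set where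
  field
    reachable   : ∀ u v → u ≢ v → ∃[ e ] Trail g U e u v
    unavoidable : ∀ x e → ¬ Trail g (_≢ x) e (proj₁ (ends g x)) (proj₂ (ends g x))

-- From sharp graphs to minimal temporal graphs

singleton : ℕ → LabelSet
singleton l = record { elements = suc l ∷ [] ; unique = [] ∷ [] ; positive = _ ∷ [] }

∈-singleton : ∀ {l m} → l ∈ singleton m → l ≡ suc m
∈-singleton (here l≡) = l≡

numbered : ∀ {n} → Graph n → TemporalGraph n
numbered g = record { graph = g ; L = singleton ∘ toℕ }

module _ {n} (g : Graph n) where

  open TemporalGraph (numbered g) using (Adjacent; JourneyFrom; step; last; TC; L)

  numbered-labels : #labels (numbered g) ≡ Graph.#edges g
  numbered-labels = sum-ones (Graph.#edges g)
    where
    sum-ones : ∀ k → foldr _+_ 0 {n = k} (λ _ → 1) ≡ k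
    sum-ones zero    = refl
    sum-ones (suc k) = cong suc (sum-ones k)

  numbered-distinct : DifferentEdgesDifferentLabels (numbered g)
  numbered-distinct e e′ e≢e′ l (here p , here q) =
    e≢e′ (Fin.toℕ-injective (ℕ.suc-injective (trans (sym p) q)))

  trail⇒journey : ∀ {e u v} → Trail g U e u v → JourneyFrom (suc (toℕ e)) u v
  trail⇒journey (last _ j)       = last (_ , j , here refl)
  trail⇒journey (step _ j e<f t) = step (_ , j , here refl) (s<s e<f) (trail⇒journey t)

  journey⇒star : ∀ {l u v} → JourneyFrom l u v → Star Adjacent u v
  journey⇒star (last (e , j , _))     = (e , j) ◅ ε
  journey⇒star (step (e , j , _) _ t) = (e , j) ◅ journey⇒star t

  module Removed (x : Edge g) where

    H : TemporalGraph n
    H = removeLabel (numbered g) x (suc (toℕ x))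

    -- Deleting the only label of `x` leaves `x` unlabelled and changes no other edge.
    surviving : ∀ {e l} → l ∈ TemporalGraph.L H e → e ≢ x × l ≡ suc (toℕ e)
    surviving {e} {l} l∈ with e Fin.≟ x
    ... | no e≢x   = e≢x , ∈-singleton
      (subst (l ∈_) (updateAt-minimal e x (singleton ∘ toℕ) e≢x) l∈)
    ... | yes refl
      with ∈-filter⁻ (λ k → ¬? (suc (toℕ x) ℕ.≟ k)) {xs = suc (toℕ x) ∷ []}
             (subst (l ∈_) (updateAt-updates x (singleton ∘ toℕ)) l∈)
    ...   | here l≡ , x≢l = contradiction (sym l≡) x≢l

    journey⇒trail : ∀ {l u v} → TemporalGraph.JourneyFrom H l u v →
                    ∃[ e ] l ≡ suc (toℕ e) × Trail g (_≢ x) e u v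
    journey⇒trail (last (e , j , l∈)) with surviving l∈
    ... | e≢x , l≡ = e , l≡ , last e≢x j
    journey⇒trail (step (e , j , l∈) l<l′ t) with surviving l∈ | journey⇒trail t
    ... | e≢x , refl | e′ , refl , t′ = e , refl , step e≢x j (ℕ.s<s⁻¹ l<l′) t′

  module _ (sharp : Sharp g) where

    open Sharp sharp

    journeys : TC
    journeys u v u≢v with reachable u v u≢v
    ... | _ , t = _ , trail⇒journey t

    numbered-minimal : Minimal (numbered g)
    numbered-minimal = record
      { connected = star
      ; tc        = journeys
      ; removal   = necessary
      }
      where
      star : ∀ u v → Star Adjacent u v
      star u v with u Fin.≟ v
      ... | yes refl = ε
      ... | no u≢v   = journey⇒star (proj₂ (journeys u v u≢v))

      necessary : ∀ e l → l ∈ L e → ¬ TemporalGraph.TC (removeLabel (numbered g) e l)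
      -- The ends of `e` are distinct because they are stored in increasing order, so connectivity
      -- after the removal would give a trail that avoids `e`.
      necessary e _ (here refl) tc
        with Removed.journey⇒trail e (proj₂ (tc _ _ (Fin.<⇒≢ (ends-ordered g e))))
      ... | f , _ , t = unavoidable e f t

-- The doubled graph

module Doubling {n} (g : Graph n) where

  private k = Graph.#edges g

  -- With a Boolean as index, `not b` is the other copy, and both directions across the rungs are
  -- treated at once.
  copyV : Bool → Fin n → Fin (n + n)
  copyV true  u = u ↑ˡ n
  copyV false u = n ↑ʳ u

  copyV-injective : ∀ b c {u v} → copyV b u ≡ copyV c v → b ≡ c × u ≡ v
  copyV-injective true  true  eq = refl , Fin.↑ˡ-injective n _ _ eq
  copyV-injective false false eq = refl , Fin.↑ʳ-injective n _ _ eq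
  copyV-injective true  false eq
    with () ← trans (sym (splitAt-↑ˡ n _ n)) (trans (cong (splitAt n) eq) (splitAt-↑ʳ n n _))
  copyV-injective false true  eq
    with () ← trans (sym (splitAt-↑ʳ n n _)) (trans (cong (splitAt n) eq) (splitAt-↑ˡ n _ n))

  copyE : Bool → Fin k → Fin (k + (k + n))
  copyE true  e = e ↑ˡ (k + n)
  copyE false e = k ↑ʳ (e ↑ˡ n)

  rung : Fin n → Fin (k + (k + n))
  rung i = k ↑ʳ (k ↑ʳ i)

  -- A structured view of edge numbers: matching on `decode f` together with `encode-decode f`
  -- replaces nested case distinctions on `splitAt`.
  data Kind : Set where
    inCopy  : Bool → Fin k → Kind
    between : Fin n → Kind

  encode : Kind → Fin (k + (k + n))
  encode (inCopy b e) = copyE b e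
  encode (between i)  = rung i

  decode : Fin (k + (k + n)) → Kind
  decode f = [ inCopy true , [ inCopy false , between ]′ ∘ splitAt k ]′ (splitAt k f)

  decode-encode : ∀ x → decode (encode x) ≡ x
  decode-encode (inCopy true e)  rewrite splitAt-↑ˡ k e (k + n) = refl
  decode-encode (inCopy false e) rewrite splitAt-↑ʳ k (k + n) (e ↑ˡ n) | splitAt-↑ˡ k e n = refl
  decode-encode (between i)    rewrite splitAt-↑ʳ k (k + n) (k ↑ʳ i) | splitAt-↑ʳ k n i = refl

  encode-decode : ∀ f → encode (decode f) ≡ f
  encode-decode f with splitAt k f in eq
  ... | inj₁ e = splitAt⁻¹-↑ˡ eq
  ... | inj₂ f′ with splitAt k f′ in eq′
  ...   | inj₁ e = trans (cong (k ↑ʳ_) (splitAt⁻¹-↑ˡ eq′)) (splitAt⁻¹-↑ʳ eq)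
  ...   | inj₂ i = trans (cong (k ↑ʳ_) (splitAt⁻¹-↑ʳ eq′)) (splitAt⁻¹-↑ʳ eq)

  toℕ-rung : ∀ i → toℕ (rung i) ≡ k + (k + toℕ i)
  toℕ-rung i = trans (toℕ-↑ʳ k _) (cong (k +_) (toℕ-↑ʳ k i))

  toℕ-copyE-false : ∀ e → toℕ (copyE false e) ≡ k + toℕ e
  toℕ-copyE-false e = trans (toℕ-↑ʳ k _) (cong (k +_) (toℕ-↑ˡ e n))

  copyE-mono-< : ∀ b {e e′} → e Fin.< e′ → copyE b e Fin.< copyE b e′
  copyE-mono-< true  e<e′ = subst₂ ℕ._<_ (sym (toℕ-↑ˡ _ _)) (sym (toℕ-↑ˡ _ _)) e<e′
  copyE-mono-< false e<e′ =
    subst₂ ℕ._<_ (sym (toℕ-copyE-false _)) (sym (toℕ-copyE-false _)) (ℕ.+-monoʳ-< k e<e′)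

  copyE-cancel-< : ∀ b {e e′} → copyE b e Fin.< copyE b e′ → e Fin.< e′
  copyE-cancel-< true  lt = subst₂ ℕ._<_ (toℕ-↑ˡ _ _) (toℕ-↑ˡ _ _) lt
  copyE-cancel-< false lt =
    ℕ.+-cancelˡ-< k _ _ (subst₂ ℕ._<_ (toℕ-copyE-false _) (toℕ-copyE-false _) lt)

  -- Serves both directions of the argument: a trail in a copy can be prolonged by a rung, and no
  -- edge of a copy can follow a rung.
  copyE<rung : ∀ b e i → copyE b e Fin.< rung i
  copyE<rung true  e i = subst₂ ℕ._<_ (sym (toℕ-↑ˡ e _)) (sym (toℕ-rung i))
    (ℕ.<-≤-trans (toℕ<n e) (ℕ.m≤m+n k _))
  copyE<rung false e i = subst₂ ℕ._<_ (sym (toℕ-copyE-false e)) (sym (toℕ-rung i))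
    (ℕ.+-monoʳ-< k (ℕ.<-≤-trans (toℕ<n e) (ℕ.m≤m+n k _)))

  endsₖ : Kind → Fin (n + n) × Fin (n + n)
  endsₖ (inCopy b e) = map (copyV b) (copyV b) (ends g e)
  endsₖ (between i)  = copyV true i , copyV false i

  endsₖ-ordered : ∀ x → proj₁ (endsₖ x) Fin.< proj₂ (endsₖ x)
  endsₖ-ordered (inCopy true e)  =
    subst₂ ℕ._<_ (sym (toℕ-↑ˡ _ n)) (sym (toℕ-↑ˡ _ n)) (ends-ordered g e)
  endsₖ-ordered (inCopy false e) =
    subst₂ ℕ._<_ (sym (toℕ-↑ʳ n _)) (sym (toℕ-↑ʳ n _)) (ℕ.+-monoʳ-< n (ends-ordered g e))
  endsₖ-ordered (between i)    =
    subst₂ ℕ._<_ (sym (toℕ-↑ˡ i n)) (sym (toℕ-↑ʳ n i)) (ℕ.<-≤-trans (toℕ<n i) (ℕ.m≤m+n n _))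

  -- The ends of a copied edge lie in one copy, while those of a rung lie in different copies.
  copy≢rung : ∀ b e i → endsₖ (inCopy b e) ≢ endsₖ (between i)
  copy≢rung b e i eq
    with () ← trans (sym (proj₁ (copyV-injective b true (,-injectiveˡ eq))))
                    (proj₁ (copyV-injective b false (,-injectiveʳ eq)))

  endsₖ-injective : ∀ x y → endsₖ x ≡ endsₖ y → x ≡ y
  endsₖ-injective (inCopy b e) (inCopy c e′) eq
    with copyV-injective b c (,-injectiveˡ eq) | copyV-injective b c (,-injectiveʳ eq)
  ... | refl , p | _ , q = cong (inCopy b) (ends-injective g (cong₂ _,_ p q))
  endsₖ-injective (inCopy b e) (between i)   eq = contradiction eq (copy≢rung b e i)
  endsₖ-injective (between i)  (inCopy b e)  eq = contradiction (sym eq) (copy≢rung b e i)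
  endsₖ-injective (between i)  (between j)   eq =
    cong between (proj₂ (copyV-injective true true (,-injectiveˡ eq)))

  double : Graph (n + n)
  double = record
    { #edges         = k + (k + n)
    ; ends           = endsₖ ∘ decode
    ; ends-ordered   = endsₖ-ordered ∘ decode
    ; ends-injective = λ {f} {f′} eq → trans (sym (encode-decode f))
        (trans (cong encode (endsₖ-injective _ _ eq)) (encode-decode f′))
    }

  -- Incidence and trails in the doubled graph

  ends-double : ∀ x → ends double (encode x) ≡ endsₖ x
  ends-double x = cong endsₖ (decode-encode x)

  joins-copy⁺ : ∀ b {e u v} → Joins g e u v → Joins double (copyE b e) (copyV b u) (copyV b v)
  joins-copy⁺ b {e} (inj₁ eq) =
    inj₁ (trans (ends-double (inCopy b e)) (cong (map (copyV b) (copyV b)) eq))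
  joins-copy⁺ b {e} (inj₂ eq) =
    inj₂ (trans (ends-double (inCopy b e)) (cong (map (copyV b) (copyV b)) eq))

  joins-copy⁻ : ∀ b {e s t} → Joins double (copyE b e) s t →
                ∃[ u ] ∃[ v ] s ≡ copyV b u × t ≡ copyV b v × Joins g e u v
  joins-copy⁻ b {e} (inj₁ eq) with refl ← trans (sym (ends-double (inCopy b e))) eq =
    _ , _ , refl , refl , inj₁ refl
  joins-copy⁻ b {e} (inj₂ eq) with refl ← trans (sym (ends-double (inCopy b e))) eq =
    _ , _ , refl , refl , inj₂ refl

  joins-rung⁺ : ∀ b i → Joins double (rung i) (copyV b i) (copyV (not b) i)
  joins-rung⁺ true  i = inj₁ (ends-double (between i))
  joins-rung⁺ false i = inj₂ (ends-double (between i))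

  joins-rung⁻ : ∀ {i s t} → Joins double (rung i) s t →
                ∃[ b ] s ≡ copyV b i × t ≡ copyV (not b) i
  joins-rung⁻ {i} (inj₁ eq) with refl ← trans (sym (ends-double (between i))) eq =
    true , refl , refl
  joins-rung⁻ {i} (inj₂ eq) with refl ← trans (sym (ends-double (between i))) eq =
    false , refl , refl

  lift : ∀ b {e u v} → Trail g U e u v → Trail double U (copyE b e) (copyV b u) (copyV b v)
  lift b (last _ j)       = last _ (joins-copy⁺ b j)
  lift b (step _ j e<f t) = step _ (joins-copy⁺ b j) (copyE-mono-< b e<f) (lift b t)

  cross : ∀ b {e u v} → Trail g U e u v → Trail double U (copyE b e) (copyV b u) (copyV (not b) v)
  cross b {e} {v = v} (last _ j) =
    step _ (joins-copy⁺ b j) (copyE<rung b e v) (last _ (joins-rung⁺ b v))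
  cross b (step _ j e<f t) = step _ (joins-copy⁺ b j) (copyE-mono-< b e<f) (cross b t)

  -- A second edge could not belong to a copy, whose edges come earlier than every rung. Were it a
  -- rung, it would share an end with `rung i`, hence be `rung i` itself, against strict increase.
  rung-last : ∀ {P : Pred (Edge double) 0ℓ} {i s t} →
              Trail double P (rung i) s t → Joins double (rung i) s t
  rung-last (last _ j) = j
  rung-last {i = i} (step {e′ = f} _ j i<f t) with decode f | encode-decode f
  ... | inCopy b e | refl = ⊥-elim (Fin.<-asym {x = copyE b e} {y = rung i} (copyE<rung b e i) i<f)
  ... | between i′ | refl with joins-rung⁻ j | joins-rung⁻ (proj₂ (first-incident t))
  ...   | b , _ , p | c , q , _ with copyV-injective (not b) c (trans (sym p) q)
  ...     | _ , refl = ⊥-elim (Fin.<-irrefl {x = rung i} refl i<f)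

  -- For a trail that changes copy, only the use of the rung at its endpoint is recorded: with `P`
  -- excluding that rung, this is already a contradiction.
  data Outcome (P : Pred (Edge double) 0ℓ) (b : Bool) (u : Fin n) :
               Edge double → Fin (n + n) → Set where
    stays   : ∀ {e v} → Trail g (P ∘ copyE b) e u v → Outcome P b u (copyE b e) (copyV b v)
    crosses : ∀ {f v} → P (rung v) → Outcome P b u f (copyV (not b) v)

  extend : ∀ {P b e f u w t} → P (copyE b e) → Joins g e u w → copyE b e Fin.< f →
           Outcome P b w f t → Outcome P b u (copyE b e) t
  extend p j e<f (crosses q)       = crosses q
  extend {b = b} p j e<f (stays t) = stays (step p j (copyE-cancel-< b e<f) t)

  -- Induction along the trail. A rung as first edge is the whole trail by `rung-last`; a copied
  -- first edge lies in copy `b`, where the trail starts, and so does the vertex it leads to.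
  outcome : ∀ {P b u f s t} → s ≡ copyV b u → Trail double P f s t → Outcome P b u f t
  outcome {f = f} s≡ t with decode f | encode-decode f
  outcome {b = b} s≡ t | between i | refl with joins-rung⁻ (rung-last t)
  ... | c , s≡′ , refl with copyV-injective b c (trans (sym s≡) s≡′)
  ...   | refl , refl = crosses (first-satisfies t)
  outcome {b = b} s≡ (last p j) | inCopy c e | refl with joins-copy⁻ c j
  ... | _ , _ , s≡′ , refl , j′ with copyV-injective b c (trans (sym s≡) s≡′)
  ...   | refl , refl = stays (last p j′)
  outcome {b = b} s≡ (step p j e<f t) | inCopy c e | refl with joins-copy⁻ c j
  ... | _ , _ , s≡′ , refl , j′ with copyV-injective b c (trans (sym s≡) s≡′)
  ...   | refl , refl = extend p j′ e<f (outcome refl t)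

  trail-within : ∀ {P b f u v} → Trail double P f (copyV b u) (copyV b v) →
                 ∃[ e ] Trail g (P ∘ copyE b) e u v
  -- `copyV` is not a constructor, so the endpoint becomes a variable with an equation before the
  -- outcome is matched.
  trail-within {b = b} {v = v} t = go (outcome refl t) refl
    where
    go : ∀ {P u f t} → Outcome P b u f t → t ≡ copyV b v → ∃[ e ] Trail g (P ∘ copyE b) e u v
    go (stays t) eq with copyV-injective b b eq
    ... | _ , refl = _ , t
    go (crosses _) eq = contradiction (sym (proj₁ (copyV-injective (not b) b eq))) (not-¬ refl)

  trail-across : ∀ {P b f u v} → Trail double P f (copyV b u) (copyV (not b) v) → P (rung v)
  trail-across {b = b} {v = v} t = go (outcome refl t) refl
    where
    go : ∀ {P u f t} → Outcome P b u f t → t ≡ copyV (not b) v → P (rung v)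
    go (stays _) eq = contradiction (proj₁ (copyV-injective b (not b) eq)) (not-¬ refl)
    go (crosses p) eq with copyV-injective (not b) (not b) eq
    ... | _ , refl = p

  -- Sharpness under doubling

  double-sharp : Sharp g → Sharp double
  double-sharp sharp = record { reachable = reach ; unavoidable = unavoid }
    where
    open Sharp sharp

    copied : ∀ s → ∃[ b ] ∃[ u ] s ≡ copyV b u
    copied s with splitAt n s in eq
    ... | inj₁ u = true , u , sym (splitAt⁻¹-↑ˡ eq)
    ... | inj₂ u = false , u , sym (splitAt⁻¹-↑ʳ eq)

    reach-same : ∀ b u v → copyV b u ≢ copyV b v → ∃[ f ] Trail double U f (copyV b u) (copyV b v)
    reach-same b u v s≢t = _ , lift b (proj₂ (reachable u v (s≢t ∘ cong (copyV b))))

    reach-other : ∀ b u v → ∃[ f ] Trail double U f (copyV b u) (copyV (not b) v)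
    reach-other b u v with u Fin.≟ v
    -- Opposite vertices are joined by their rung alone; otherwise a trail within the copy comes
    -- first.
    ... | yes refl = _ , last _ (joins-rung⁺ b u)
    ... | no u≢v   = _ , cross b (proj₂ (reachable u v u≢v))

    reach : ∀ s t → s ≢ t → ∃[ f ] Trail double U f s t
    reach s t s≢t with copied s | copied t
    ... | true  , u , refl | true  , v , refl = reach-same true u v s≢t
    ... | false , u , refl | false , v , refl = reach-same false u v s≢t
    ... | true  , u , refl | false , v , refl = reach-other true u v
    ... | false , u , refl | true  , v , refl = reach-other false u v

    unavoidₖ : ∀ x f → ¬ Trail double (_≢ encode x) f (proj₁ (endsₖ x)) (proj₂ (endsₖ x))
    -- The trail must use `rung i`, the very edge it avoids.
    unavoidₖ (between i)  f t = trail-across {b = true} t refl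
    unavoidₖ (inCopy b x) f t with trail-within {b = b} t
    -- Avoiding `copyE b x` in the doubled graph means avoiding `x` in the copy, as equal edges have
    -- equal copies.
    ... | e , t′ = unavoidable x e (mapTrail (_∘ cong (copyE b)) t′)

    unavoid : ∀ x f → ¬ Trail double (_≢ x) f (proj₁ (ends double x)) (proj₂ (ends double x))
    -- The ends of `x` are by definition those of `decode x`; only the avoided edge needs transport.
    unavoid x f = subst
      (λ y → ¬ Trail double (_≢ y) f (proj₁ (ends double x)) (proj₂ (ends double x)))
      (encode-decode x) (unavoidₖ (decode x) f)

-- Hypercubes and their number of edges

open Doubling using (double; double-sharp)

-- 2 ^ d, but with the order of double (cube d) as definitional unfolding.
order : ℕ → ℕ
order zero    = 1
order (suc d) = order d + order d

cube : ∀ d → Graph (order d)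
cube zero    = record
  { #edges = 0 ; ends = λ () ; ends-ordered = λ () ; ends-injective = λ { {()} } }
cube (suc d) = double (cube d)

cube-sharp : ∀ d → Sharp (cube d)
cube-sharp zero    = record
  { reachable = λ { Fin.zero Fin.zero 0≢0 → contradiction refl 0≢0 } ; unavoidable = λ () }
cube-sharp (suc d) = double-sharp (cube d) (cube-sharp d)

order≡2^ : ∀ d → order d ≡ 2 ^ d
order≡2^ zero    = refl
order≡2^ (suc d) = cong₂ _+_ (order≡2^ d) (trans (order≡2^ d) (sym (ℕ.+-identityʳ (2 ^ d))))

d<order : ∀ d → d ℕ.< order d
d<order zero    = z<s
d<order (suc d) = ℕ.+-mono-≤ (ℕ.≤-<-trans ℕ.z≤n (d<order d)) (d<order d)

n·log-order : ∀ d → n·log (order d) ≡ order d * d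
n·log-order d = cong (order d *_) (trans (cong ⌊log₂_⌋ (order≡2^ d)) (⌊log₂[2^n]⌋≡n d))

-- Stated for twice the number of edges to avoid halving. The induction follows the recurrence of
-- the doubling: two copies of `k` edges and `m` rungs.
cube-edges : ∀ d → 2 * Graph.#edges (cube d) ≡ n·log (order d)
cube-edges d = trans (count d) (sym (n·log-order d))
  where
  open ≡-Reasoning

  regroup : ∀ k m → 2 * (k + (k + m)) ≡ 2 * k + 2 * k + 2 * m
  regroup = solve-∀

  collect : ∀ m d → m * d + m * d + 2 * m ≡ (m + m) * suc d
  collect = solve-∀

  count : ∀ d → 2 * Graph.#edges (cube d) ≡ order d * d
  count zero    = refl
  count (suc d) = begin
    2 * (k + (k + m))       ≡⟨ regroup k m ⟩
    2 * k + 2 * k + 2 * m   ≡⟨ cong (λ x → x + x + 2 * m) (count d) ⟩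
    m * d + m * d + 2 * m   ≡⟨ collect m d ⟩
    (m + m) * suc d         ∎
    where
    k = Graph.#edges (cube d)
    m = order d

-- The class of cubes and its asymptotics

data Cubes : Class where
  mk : ∀ d → Cubes (order d) (numbered (cube d))

Θ-half : ∀ (f : ∀ {n} → TemporalGraph n → ℕ) →
         (∀ d → 2 * f (numbered (cube d)) ≡ n·log (order d)) → Θ[ Cubes ] f n·log
-- As `2 * f` equals `n·log` exactly, the factor 2 turns the lower bound into an equality, and `f`
-- being at most `2 * f` gives the upper bound with factor 1, for all orders from 0 on.
Θ-half f twice = 2 , 1 , 0 , _ , _ , λ { _ _ _ (mk d) →
  ℕ.≤-reflexive (sym (twice d)) ,
  ℕ.≤-trans (ℕ.m≤n*m (f (numbered (cube d))) 2)
    (ℕ.≤-reflexive (trans (twice d) (sym (ℕ.*-identityˡ _)))) }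

theorem3 : ∃[ 𝒞 ] Infinite 𝒞
    × (∀ n G → 𝒞 n G → Minimal G × DifferentEdgesDifferentLabels G)
    × Θ[ 𝒞 ] #edges n·log
    × Θ[ 𝒞 ] #labels n·log
theorem3 = Cubes
  , (λ N → order N , ℕ.<⇒≤ (d<order N) , numbered (cube N) , mk N)
  , (λ { _ _ (mk d) → numbered-minimal (cube d) (cube-sharp d) , numbered-distinct (cube d) })
  , Θ-half #edges cube-edges
  -- With one label on each edge, the label count is the edge count.
  , Θ-half #labels (λ d → trans (cong (2 *_) (numbered-labels (cube d))) (cube-edges d))
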